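{- Let $M$ be a CNM of size $n\ge 1$. Then there exist $N\ge 0$ and a sequence $M_0=M,M_1,\dots,M_N$ of CNMs of size $n$ such that for each $0\le i<N$, $M_{i+1}$ is obtained from $M_i$ by interchanging two rows or interchanging two columns, and $M_N$ is upper-diagonal.
   Context: A complete non-ambiguous matrix (CNM) of size $n$ is an $n\times n$ matrix $M=(m_{i,j})$ with entries in $\{0,1\}$ whose support $T=\{(i,j): m_{i,j}=1\}$ (whose elements are called vertices) satisfies: (1) $(1,1)\in T$; (2) for every $p=(i,j)\in T$ with $p\neq(1,1)$, exactly one of the following holds: there is $(i',j)\in T$ with $i'<i$, or there is $(i,j')\in T$ with $j'<j$; (3) every row and every column of $M$ contains at least one vertex; (4) define the parent of $p=(i,j)\neq(1,1)$ to be $(i',j)$ with $i'<i$ maximal if such a vertex exists, and otherwise $(i,j')$ with $j'<j$ maximal; then every vertex is the parent of either zero or exactly two vertices. A vertex with no children is a leaf. A CNM of size $n$ is upper-diagonal if its leaves are exactly the positions $(i,n+1-i)$, $1\le i\le n$. -}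

module Defs where

open import Data.Nat using (ℕ; suc)
open import Data.Bool using (Bool; true)
open import Data.Fin using (Fin; zero; _<_; _≤_; opposite)
open import Data.Fin.Permutation.Components using (transpose)
open import Data.Product using (_×_; _,_; ∃-syntax)
open import Data.Sum using (_⊎_)
open import Function.Bundles using (_⇔_)
open import Relation.Nullary using (¬_)
open import Relation.Binary.PropositionalEquality using (_≡_; _≢_)

-- 0/1 matrices, with 1 encoded as true. Rows and columns are numbered from 0.
Matrix : ℕ → Set
Matrix n = Fin n → Fin n → Bool

Pos : ℕ → Set
Pos n = Fin n × Fin n

module _ {n : ℕ} (M : Matrix n) where

  Vertex : Pos n → Set
  Vertex (i , j) = M i j ≡ true

  VertexAbove : Pos n → Set
  VertexAbove (i , j) = ∃[ i′ ] (i′ < i × Vertex (i′ , j))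

  VertexLeft : Pos n → Set
  VertexLeft (i , j) = ∃[ j′ ] (j′ < j × Vertex (i , j′))

  -- Parent p q : p is the parent of q. No q ≢ (0 , 0) is needed, since
  -- nothing lies above or to the left of (0 , 0).
  data Parent : Pos n → Pos n → Set where
    above : ∀ {i i′ j} → Vertex (i , j) → Vertex (i′ , j) → i′ < i →
            (∀ k → k < i → Vertex (k , j) → k ≤ i′) →
            Parent (i′ , j) (i , j)
    left  : ∀ {i j j′} → Vertex (i , j) → ¬ VertexAbove (i , j) →
            Vertex (i , j′) → j′ < j →
            (∀ k → k < j → Vertex (i , k) → k ≤ j′) →
            Parent (i , j′) (i , j)

  NoChildren : Pos n → Set
  NoChildren p = ∀ q → ¬ Parent p q

  ExactlyTwoChildren : Pos n → Set
  ExactlyTwoChildren p =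
    ∃[ q ] ∃[ r ] (q ≢ r × Parent p q × Parent p r ×
                   (∀ s → Parent p s → s ≡ q ⊎ s ≡ r))

  Leaf : Pos n → Set
  Leaf p = Vertex p × NoChildren p

  -- In 0-based numbering the antidiagonal positions (i , n+1-i) become
  -- (i , n-1-i), and opposite i is n-1-i.
  UpperDiagonal : Set
  UpperDiagonal = ∀ i j → Leaf (i , j) ⇔ j ≡ opposite i

record IsCNM {n : ℕ} (M : Matrix (suc n)) : Set where
  field
    root     : Vertex M (zero , zero)
    oneSided : ∀ p → Vertex M p → p ≢ (zero , zero) →
               (VertexAbove M p ⊎ VertexLeft M p) ×
               ¬ (VertexAbove M p × VertexLeft M p)
    rows     : ∀ i → ∃[ j ] Vertex M (i , j)
    columns  : ∀ j → ∃[ i ] Vertex M (i , j)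
    complete : ∀ p → Vertex M p → NoChildren M p ⊎ ExactlyTwoChildren M p

RowInterchange : ∀ {n} → Matrix n → Matrix n → Set
RowInterchange M M′ =
  ∃[ a ] ∃[ b ] (a ≢ b × (∀ i j → M′ i j ≡ M (transpose a b i) j))

ColumnInterchange : ∀ {n} → Matrix n → Matrix n → Set
ColumnInterchange M M′ =
  ∃[ a ] ∃[ b ] (a ≢ b × (∀ i j → M′ i j ≡ M i (transpose a b j)))

Interchange : ∀ {n} → Matrix n → Matrix n → Set
Interchange M M′ = RowInterchange M M′ ⊎ ColumnInterchange M M′

{-# OPTIONS --safe #-}
-- A non-leaf vertex of a CNM has exactly one child in its row and one in its column, so a vertex ends
-- its row iff it ends its column.  Exchanging two adjacent rows with disjoint supports keeps all the
-- axioms, so bubble sort may be applied to the rows by any key such that each inverted pair of rows is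
-- disjoint, and likewise to the columns.  First, the rows with a single vertex are moved below all
-- the others and arranged so that their columns decrease.  Afterwards the columns are sorted by decreasing
-- position of their last vertex.  If two columns inverted for this second sort met a common row, the last
-- vertices of both would be single in their rows, against the order reached by the first sort.
module Submission where

open import Defs
open import Data.Bool using (Bool; true)
open import Data.Bool.Properties using () renaming (_≟_ to _≟ᵇ_)
open import Data.Empty using (⊥-elim)
open import Data.Nat using (ℕ; suc; zero; _+_; _*_; z≤n; s≤s)
import Data.Nat as ℕ
import Data.Nat.Induction as ℕ
import Data.Nat.Properties as ℕ
open import Data.Nat.Tactic.RingSolver using (solve-∀)
open import Data.Fin using (Fin; zero; suc; inject₁; fromℕ; toℕ; opposite; _<_; _≤_)
open import Data.Fin.Induction using (<-weakInduction; <-weakInduction-startingFrom; >-weakInduction)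
open import Data.Fin.Permutation.Components using (transpose)
open import Data.Fin.Properties using
  (_≟_; _<?_; any?; <-cmp; ≤∧≢⇒<; suc-injective; toℕ-injective; toℕ-inject₁; ≤fromℕ;
   opposite-prop; opposite-involutive)
open import Data.Product using (_×_; _,_; proj₁; proj₂; ∃-syntax; Σ-syntax; swap)
open import Data.Product.Properties using (,-injectiveˡ)
open import Data.Sum using (_⊎_; inj₁; inj₂)
import Data.Sum as Sum
open import Function using (_∘_; flip)
open import Function.Bundles using (_⇔_; mk⇔; Equivalence)
open import Induction.WellFounded using (Acc; acc)
open import Relation.Binary.Construct.Closure.ReflexiveTransitive using (Star; ε; _◅_; _◅◅_; gmap)
open import Relation.Binary.Definitions using (tri<; tri≈; tri>)
open import Relation.Binary.PropositionalEquality using (_≡_; _≢_; refl; sym; trans; cong; cong₂; subst; subst₂)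
open import Relation.Nullary using (¬_; yes; no; contradiction)
open import Relation.Nullary.Decidable using (_×-dec_)
open import Relation.Unary using (Decidable)

open Equivalence using (to; from)

private
  variable
    n : ℕ

-- Extremal elements and monotone maps of finite ordinals.

least : {P : Fin n → Set} → Decidable P → ∃[ i ] P i →
        ∃[ i ] (P i × (∀ k → P k → i ≤ k))
least {suc n} P? (i , Pi) with P? zero
... | yes P0 = zero , P0 , λ _ _ → z≤n
least {suc n} P? (zero , Pi) | no ¬P0 = contradiction Pi ¬P0
least {suc n} P? (suc i , Pi) | no ¬P0 with least (P? ∘ suc) (i , Pi)
... | j , Pj , min = suc j , Pj , λ { zero P0 → contradiction P0 ¬P0 ; (suc k) Pk → s≤s (min k Pk) }

greatest : {P : Fin n → Set} → Decidable P → ∃[ i ] P i →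
           ∃[ i ] (P i × (∀ k → P k → k ≤ i))
greatest {suc n} P? (i , Pi) with any? (P? ∘ suc)
... | yes ∃P with greatest (P? ∘ suc) ∃P
...   | j , Pj , max = suc j , Pj , λ { zero _ → z≤n ; (suc k) Pk → s≤s (max k Pk) }
greatest {suc n} P? (zero , Pi) | no ∄P = zero , Pi , λ { zero _ → z≤n ; (suc k) Pk → contradiction (k , Pk) ∄P }
greatest {suc n} P? (suc i , Pi) | no ∄P = contradiction (i , Pi) ∄P

adjacent-mono : (f : Fin (suc n) → ℕ) → (∀ k → f (inject₁ k) ℕ.≤ f (suc k)) →
                ∀ {i j} → i ≤ j → f i ℕ.≤ f j
adjacent-mono f step {i} =
  <-weakInduction-startingFrom (λ j → f i ℕ.≤ f j) ℕ.≤-refl (λ k fi≤fk → ℕ.≤-trans fi≤fk (step k))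

-- Induction upwards from `zero` gives `i ≤ f i`; induction downwards from the last index gives
-- `f i ≤ i`.
strictMono⇒id : (f : Fin (suc n) → Fin (suc n)) → (∀ {i j} → i < j → f i < f j) → ∀ i → f i ≡ i
strictMono⇒id f mono i = toℕ-injective (ℕ.≤-antisym (f≤ i) (f≥ i))
  where
  inject₁<suc : ∀ {n} (k : Fin n) → inject₁ k < suc k
  inject₁<suc k = s≤s (ℕ.≤-reflexive (toℕ-inject₁ k))
  f≥ : ∀ i → i ≤ f i
  f≥ = <-weakInduction _ z≤n λ k k≤fk →
    ℕ.≤-trans (s≤s (subst (ℕ._≤ toℕ (f (inject₁ k))) (toℕ-inject₁ k) k≤fk)) (mono (inject₁<suc k))
  f≤ : ∀ i → f i ≤ i
  f≤ = >-weakInduction _ (≤fromℕ _) λ k fk≤k →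
    subst (toℕ (f (inject₁ k)) ℕ.≤_) (sym (toℕ-inject₁ k)) (ℕ.s≤s⁻¹ (ℕ.≤-trans (mono (inject₁<suc k)) fk≤k))

opposite-anti-≤ : {i j : Fin n} → i ≤ j → opposite j ≤ opposite i
opposite-anti-≤ {n} {i} {j} i≤j =
  subst₂ ℕ._≤_ (sym (opposite-prop j)) (sym (opposite-prop i)) (ℕ.∸-monoʳ-≤ n (s≤s i≤j))

opposite-cancel-≤ : {i j : Fin n} → opposite j ≤ opposite i → i ≤ j
opposite-cancel-≤ {i = i} {j} le =
  subst₂ _≤_ (opposite-involutive i) (opposite-involutive j) (opposite-anti-≤ le)

opposite-cancel-< : {i j : Fin n} → opposite j < opposite i → i < j
opposite-cancel-< lt = ℕ.≰⇒> (λ j≤i → ℕ.<⇒≱ lt (opposite-anti-≤ j≤i))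

-- Adjacent transpositions and the sorting measure.

transpose-cases : (a b i : Fin n) →
                  (i ≡ a × transpose a b i ≡ b) ⊎ (i ≡ b × transpose a b i ≡ a) ⊎
                  (i ≢ a × i ≢ b × transpose a b i ≡ i)
transpose-cases a b i with i ≟ a
... | yes i≡a = inj₁ (i≡a , refl)
... | no i≢a with i ≟ b
...   | yes i≡b = inj₂ (inj₁ (i≡b , refl))
...   | no i≢b  = inj₂ (inj₂ (i≢a , i≢b , refl))

transpose-left : (a b : Fin n) → transpose a b a ≡ b
transpose-left a b with transpose-cases a b a
... | inj₁ (_ , e)                = e
... | inj₂ (inj₁ (a≡b , e))       = trans e a≡b
... | inj₂ (inj₂ (a≢a , _ , _))   = contradiction refl a≢a

transpose-right : (a b : Fin n) → transpose a b b ≡ a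
transpose-right a b with transpose-cases a b b
... | inj₁ (b≡a , e)              = trans e b≡a
... | inj₂ (inj₁ (_ , e))         = e
... | inj₂ (inj₂ (_ , b≢b , _))   = contradiction refl b≢b

transpose-other : {a b i : Fin n} → i ≢ a → i ≢ b → transpose a b i ≡ i
transpose-other {a = a} {b} {i} i≢a i≢b with transpose-cases a b i
... | inj₁ (i≡a , _)              = contradiction i≡a i≢a
... | inj₂ (inj₁ (i≡b , _))       = contradiction i≡b i≢b
... | inj₂ (inj₂ (_ , _ , e))     = e

transpose-involutive : (a b i : Fin n) → transpose a b (transpose a b i) ≡ i
transpose-involutive a b i with transpose-cases a b i
... | inj₁ (refl , e)             = trans (cong (transpose a b) e) (transpose-right a b)
... | inj₂ (inj₁ (refl , e))      = trans (cong (transpose a b) e) (transpose-left a b)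
... | inj₂ (inj₂ (_ , _ , e))     = trans (cong (transpose a b) e) e

module _ {a b : Fin n} (adjacent : toℕ b ≡ suc (toℕ a)) where

  private
    a<b : a < b
    a<b = ℕ.≤-reflexive (sym adjacent)

    above-a : ∀ {j} → a < j → j ≢ b → b < j
    above-a {j} a<j j≢b = ≤∧≢⇒< (subst (ℕ._≤ toℕ j) (sym adjacent) a<j) (j≢b ∘ sym)

    below-b : ∀ {i} → i < b → i ≢ a → i < a
    below-b {i} i<b i≢a = ≤∧≢⇒< (ℕ.s≤s⁻¹ (subst (toℕ i ℕ.<_) adjacent i<b)) i≢a

  -- No index lies strictly between `a` and `b`, so every third index compares with both in the same
  -- way.
  transpose-mono-< : ∀ {i j} → i < j → ¬ (i ≡ a × j ≡ b) → transpose a b i < transpose a b j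
  transpose-mono-< {i} {j} i<j ¬ab with transpose-cases a b i | transpose-cases a b j
  ... | inj₁ (refl , e) | inj₁ (refl , _) = contradiction i<j (ℕ.<-irrefl refl)
  ... | inj₁ (refl , e) | inj₂ (inj₁ (refl , _)) = contradiction (refl , refl) ¬ab
  ... | inj₁ (refl , e) | inj₂ (inj₂ (_ , j≢b , e′)) = subst₂ _<_ (sym e) (sym e′) (above-a i<j j≢b)
  ... | inj₂ (inj₁ (refl , e)) | inj₁ (refl , _) = contradiction i<j (ℕ.<-asym a<b)
  ... | inj₂ (inj₁ (refl , e)) | inj₂ (inj₁ (refl , _)) = contradiction i<j (ℕ.<-irrefl refl)
  ... | inj₂ (inj₁ (refl , e)) | inj₂ (inj₂ (_ , _ , e′)) = subst₂ _<_ (sym e) (sym e′) (ℕ.<-trans a<b i<j)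
  ... | inj₂ (inj₂ (_ , _ , e)) | inj₁ (refl , e′) = subst₂ _<_ (sym e) (sym e′) (ℕ.<-trans i<j a<b)
  ... | inj₂ (inj₂ (i≢a , _ , e)) | inj₂ (inj₁ (refl , e′)) = subst₂ _<_ (sym e) (sym e′) (below-b i<j i≢a)
  ... | inj₂ (inj₂ (_ , _ , e)) | inj₂ (inj₂ (_ , _ , e′)) = subst₂ _<_ (sym e) (sym e′) i<j

-- The termination measure of bubble sort: earlier entries count more.
weight : (Fin n → ℕ) → ℕ
weight {zero}  f = 0
weight {suc n} f = f zero * n + weight (f ∘ suc)

weight-cong : {f g : Fin n → ℕ} → (∀ i → g i ≡ f i) → weight g ≡ weight f
weight-cong {zero}  e = refl
weight-cong {suc n} e = cong₂ _+_ (cong (_* n) (e zero)) (weight-cong (e ∘ suc))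

-- The coefficients in `weight` fall by one from each entry to the next, so moving the smaller of
-- two neighbours forward lowers the sum by their difference.
weight-swap : (k : Fin n) (f g : Fin (suc n) → ℕ) →
              g (inject₁ k) ≡ f (suc k) → g (suc k) ≡ f (inject₁ k) →
              (∀ i → i ≢ inject₁ k → i ≢ suc k → g i ≡ f i) →
              f (suc k) ℕ.< f (inject₁ k) → weight g ℕ.< weight f
weight-swap {suc m} zero f g e₁ e₂ other lt
  rewrite e₁ | e₂ | weight-cong {f = λ i → f (suc (suc i))} {λ i → g (suc (suc i))} (λ i → other (suc (suc i)) (λ ()) (λ ()))
  = lemma (f (suc zero)) (f zero) (weight (λ i → f (suc (suc i)))) lt
  where
  shuffle : ∀ x y m w → x * suc m + (y * m + w) ≡ x + (x * m + y * m + w)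
  shuffle = solve-∀
  lemma : ∀ x y w → x ℕ.< y → x * suc m + (y * m + w) ℕ.< y * suc m + (x * m + w)
  lemma x y w x<y rewrite shuffle x y m w | shuffle y x m w | ℕ.+-comm (y * m) (x * m) = ℕ.+-monoˡ-< _ x<y
weight-swap {suc m} (suc k) f g e₁ e₂ other lt
  rewrite other zero (λ ()) (λ ())
  = ℕ.+-monoʳ-< (f zero * suc m)
      (weight-swap k (f ∘ suc) (g ∘ suc) e₁ e₂
        (λ i p q → other (suc i) (p ∘ suc-injective) (q ∘ suc-injective)) lt)

-- Children and balanced vertices.

module _ (M : Matrix n) where

  VertexBelow : Pos n → Set
  VertexBelow (i , j) = ∃[ i′ ] (i < i′ × Vertex M (i′ , j))

  VertexRight : Pos n → Set
  VertexRight (i , j) = ∃[ j′ ] (j < j′ × Vertex M (i , j′))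

  -- Together with `NoCorner` this replaces the axiom `complete`. It avoids parents and maximality,
  -- so it is easy to carry through a transposition of the matrix or an exchange of rows.
  Balanced : Set
  Balanced = ∀ p → Vertex M p → VertexBelow p ⇔ VertexRight p

  NoCorner : Set
  NoCorner = ∀ p → Vertex M p → ¬ (VertexAbove M p × VertexLeft M p)

  vertexBelow? : Decidable VertexBelow
  vertexBelow? (i , j) = any? (λ i′ → (i <? i′) ×-dec (M i′ j ≟ᵇ true))

-- The smaller of two distinct candidates would violate the bound attached to the larger. Hence a
-- vertex has at most one child in its column and at most one in its row.
next-unique : {P : Fin n → Set} {i x y : Fin n} → i < x → i < y → P x → P y →
              (∀ k → k < x → P k → k ≤ i) → (∀ k → k < y → P k → k ≤ i) → x ≡ y
next-unique {x = x} {y} i<x i<y Px Py maxx maxy with <-cmp x y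
... | tri≈ _ x≡y _ = x≡y
... | tri< x<y _ _ = contradiction (maxy x x<y Px) (ℕ.<⇒≱ i<x)
... | tri> _ _ y<x = contradiction (maxx y y<x Py) (ℕ.<⇒≱ i<y)

module _ {M : Matrix n} where

  childBelow : ∀ {i j} → Vertex M (i , j) → VertexBelow M (i , j) → ∃[ i′ ] Parent M (i , j) (i′ , j)
  childBelow {i} {j} v ∃below with least (λ i′ → (i <? i′) ×-dec (M i′ j ≟ᵇ true)) ∃below
  ... | i′ , (i<i′ , v′) , min =
    i′ , above v′ v i<i′ λ k k<i′ w → ℕ.≮⇒≥ λ i<k → ℕ.<⇒≱ k<i′ (min k (i<k , w))

  -- The next vertex of the row has `(i , j)` to its left, so `NoCorner` leaves nothing above it
  -- that could be its parent instead.
  childRight : NoCorner M → ∀ {i j} → Vertex M (i , j) → VertexRight M (i , j) → ∃[ j′ ] Parent M (i , j) (i , j′)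
  childRight noCorner {i} {j} v ∃right with least (λ j′ → (j <? j′) ×-dec (M i j′ ≟ᵇ true)) ∃right
  ... | j′ , (j<j′ , v′) , min =
    j′ , left v′ (λ ∃above → noCorner _ v′ (∃above , j , j<j′ , v)) v j<j′
           λ k k<j′ w → ℕ.≮⇒≥ λ j<k → ℕ.<⇒≱ k<j′ (min k (j<k , w))

  twoChildren : ∀ {i j i′ j′} → Parent M (i , j) (i′ , j) → Parent M (i , j) (i , j′) → ExactlyTwoChildren M (i , j)
  twoChildren (left _ _ _ j<j _) _ = contradiction j<j (ℕ.<-irrefl refl)
  twoChildren (above _ _ _ _) (above _ _ i<i _) = contradiction i<i (ℕ.<-irrefl refl)
  twoChildren p@(above v′ _ i<i′ max) q@(left w′ _ _ j<j′ max′) =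
    _ , _ , (λ e → ℕ.<-irrefl (cong toℕ (sym (,-injectiveˡ e))) i<i′) , p , q , λ where
      _ (above x _ lt m)  → inj₁ (cong (_, _) (next-unique lt i<i′ x v′ m max))
      _ (left x _ _ lt m) → inj₂ (cong (_ ,_) (next-unique lt j<j′ x w′ m max′))

module _ {M : Matrix (suc n)} (cnm : IsCNM M) where
  open IsCNM cnm

  noCorner : NoCorner M
  noCorner p v both@((i′ , i′<i , _) , _) = proj₂ (oneSided p v λ { refl → ℕ.n≮0 i′<i }) both

  -- By `next-unique`, two distinct children lie neither both in the column nor both in the row, so
  -- there is one in each. A childless vertex has nothing below it or to its right, since the
  -- nearest such vertex would be a child.
  balanced : Balanced M
  balanced p@(i , j) v = helper (complete p v)
    where
    helper : NoChildren M p ⊎ ExactlyTwoChildren M p → VertexBelow M p ⇔ VertexRight M p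
    helper (inj₁ none) = mk⇔
      (λ ∃below → ⊥-elim (none _ (proj₂ (childBelow v ∃below))))
      (λ ∃right → ⊥-elim (none _ (proj₂ (childRight noCorner v ∃right))))
    helper (inj₂ (_ , _ , q≢r , above x _ lt m , above x′ _ lt′ m′ , _)) =
      contradiction (cong (_, j) (next-unique lt lt′ x x′ m m′)) q≢r
    helper (inj₂ (_ , _ , q≢r , left x _ _ lt m , left x′ _ _ lt′ m′ , _)) =
      contradiction (cong (i ,_) (next-unique lt lt′ x x′ m m′)) q≢r
    helper (inj₂ (_ , _ , _ , above x _ lt _ , left x′ _ _ lt′ _ , _)) =
      mk⇔ (λ _ → _ , lt′ , x′) (λ _ → _ , lt , x)
    helper (inj₂ (_ , _ , _ , left x _ _ lt _ , above x′ _ lt′ _ , _)) =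
      mk⇔ (λ _ → _ , lt , x) (λ _ → _ , lt′ , x′)

balanced⇒complete : {M : Matrix n} → NoCorner M → Balanced M →
                    ∀ p → Vertex M p → NoChildren M p ⊎ ExactlyTwoChildren M p
balanced⇒complete {M = M} nc bal p v with vertexBelow? M p
... | yes ∃below = inj₂ (twoChildren (proj₂ (childBelow v ∃below)) (proj₂ (childRight nc v (to (bal p v) ∃below))))
... | no ∄below = inj₁ λ where
  _ (above x _ lt _)  → ∄below (_ , lt , x)
  _ (left x _ _ lt _) → ∄below (from (bal p v) (_ , lt , x))

-- The parent rule prefers columns to rows, so the symmetry of `complete` is not visible directly.
-- It is read off from `NoCorner` and `Balanced`, which are both symmetric.
isCNM-flip : {M : Matrix (suc n)} → IsCNM M → IsCNM (flip M)
isCNM-flip {M = M} cnm = record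
  { root     = root
  ; oneSided = λ (i , j) v p≢0 →
      Sum.swap (proj₁ (oneSided (j , i) v λ { refl → p≢0 refl })) , noCorner cnm (j , i) v ∘ swap
  ; rows     = columns
  ; columns  = rows
  ; complete = balanced⇒complete
      (λ (i , j) v → noCorner cnm (j , i) v ∘ swap)
      (λ (i , j) v → let b = balanced cnm (j , i) v in mk⇔ (from b) (to b))
  }
  where open IsCNM cnm

-- Exchange of adjacent disjoint rows.

DisjointRows : Matrix n → Fin n → Fin n → Set
DisjointRows M a b = ∀ j → Vertex M (a , j) → ¬ Vertex M (b , j)

module _ {M : Matrix (suc n)} (cnm : IsCNM M) {a b : Fin (suc n)}
         (adjacent : toℕ b ≡ suc (toℕ a)) (disjoint : DisjointRows M a b) where
  open IsCNM cnm

  private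
    t : Fin (suc n) → Fin (suc n)
    t = transpose a b

    t² : ∀ i → t (t i) ≡ i
    t² = transpose-involutive a b

    M′ : Matrix (suc n)
    M′ = M ∘ t

    t-mono : ∀ {i i′ j} → Vertex M (i , j) → Vertex M (i′ , j) → i < i′ → t i < t i′
    t-mono v v′ i<i′ = transpose-mono-< adjacent i<i′ λ { (refl , refl) → disjoint _ v v′ }

    t-mono′ : ∀ {i i′ j} → Vertex M′ (i , j) → Vertex M′ (i′ , j) → i < i′ → t i < t i′
    t-mono′ {j = j} v v′ i<i′ = transpose-mono-< adjacent i<i′ λ { (refl , refl) →
      disjoint j (subst (λ r → Vertex M (r , j)) (transpose-right a b) v′)
                 (subst (λ r → Vertex M (r , j)) (transpose-left a b) v) }

    above⇒ : ∀ {i j} → Vertex M′ (i , j) → VertexAbove M′ (i , j) → VertexAbove M (t i , j)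
    above⇒ v (i′ , lt , v′) = t i′ , t-mono′ v′ v lt , v′

    below⇒ : ∀ {i j} → Vertex M′ (i , j) → VertexBelow M′ (i , j) → VertexBelow M (t i , j)
    below⇒ v (i′ , lt , v′) = t i′ , t-mono′ v v′ lt , v′

    at-t² : ∀ {i j} → Vertex M (i , j) → Vertex M′ (t i , j)
    at-t² {i} {j} = subst (λ r → Vertex M (r , j)) (sym (t² i))

    above⇐ : ∀ {i j} → Vertex M′ (i , j) → VertexAbove M (t i , j) → VertexAbove M′ (i , j)
    above⇐ {i} v (i′ , lt , v′) = t i′ , subst (t i′ <_) (t² i) (t-mono v′ v lt) , at-t² v′

    below⇐ : ∀ {i j} → Vertex M′ (i , j) → VertexBelow M (t i , j) → VertexBelow M′ (i , j)
    below⇐ {i} v (i′ , lt , v′) = t i′ , subst (_< t i′) (t² i) (t-mono v v′ lt) , at-t² v′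

    -- The first vertex of row 1 lies below a vertex of row 0, so row 0 takes no part in the exchange.
    a≢0 : a ≢ zero
    a≢0 refl with least (λ j → M b j ≟ᵇ true) (rows b)
    ... | j , v , first with proj₁ (oneSided (b , j) v (λ { refl → contradiction adjacent λ () }))
    ...   | inj₁ (i′ , i′<b , v′) = disjoint j (subst (λ r → Vertex M (r , j)) i′≡0 v′) v
      where
      i′≡0 : i′ ≡ zero
      i′≡0 = toℕ-injective (ℕ.n≤0⇒n≡0 (ℕ.s≤s⁻¹ (subst (toℕ i′ ℕ.<_) adjacent i′<b)))
    ...   | inj₂ (j′ , j′<j , v′) = ℕ.<⇒≱ j′<j (first j′ v′)

    t0≡0 : t zero ≡ zero
    t0≡0 = transpose-other (a≢0 ∘ sym) λ { refl → contradiction adjacent λ () }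

    noCorner′ : NoCorner M′
    noCorner′ (i , j) v (∃above , ∃left) = noCorner cnm (t i , j) v (above⇒ v ∃above , ∃left)

  -- No column meets both exchanged rows, so the vertical order of the vertices in each column
  -- survives, and rows are moved whole. Thus `t` carries all four relations (above, below, left,
  -- right) along.
  isCNM-swap : IsCNM M′
  isCNM-swap = record
    { root     = subst (λ r → Vertex M (r , zero)) (sym t0≡0) root
    ; oneSided = λ (i , j) v p≢0 →
        -- Since `t` is an involution fixing `zero`, a vertex other than the root comes from a
        -- vertex other than the root.
        Sum.map₁ (above⇐ v) (proj₁ (oneSided (t i , j) v λ e →
          p≢0 (cong₂ _,_ (trans (sym (t² i)) (trans (cong t (cong proj₁ e)) t0≡0)) (cong proj₂ e))))
        , noCorner′ (i , j) v
    ; rows     = λ i → rows (t i)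
    ; columns  = λ j → let i , v = columns j in t i , at-t² v
    ; complete = balanced⇒complete noCorner′ λ (i , j) v →
        let b = balanced cnm (t i , j) v in mk⇔ (to b ∘ below⇒ v) (below⇐ v ∘ from b)
    }

-- Bubble sort of the rows.

Step : Matrix (suc n) → Matrix (suc n) → Set
Step M M′ = IsCNM M′ × Interchange M M′

-- Disjointness is assumed for all inversions, because distant rows may become neighbours during the
-- sort. Each exchange of an inverted adjacent pair decreases `weight`.
sortRows : (M : Matrix (suc n)) → IsCNM M → (key : Fin (suc n) → ℕ) →
           (∀ a b → a < b → key b ℕ.< key a → DisjointRows M a b) →
           ∃[ σ ] (IsCNM (M ∘ σ) × Star Step M (M ∘ σ) × (∀ {a b} → a ≤ b → key (σ a) ℕ.≤ key (σ b)))
sortRows {n} M₀ cnm₀ key₀ disj₀ = go M₀ cnm₀ key₀ disj₀ (ℕ.<-wellFounded _)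
  where
  go : (M : Matrix (suc n)) → IsCNM M → (key : Fin (suc n) → ℕ) →
       (∀ a b → a < b → key b ℕ.< key a → DisjointRows M a b) → Acc ℕ._<_ (weight key) →
       ∃[ σ ] (IsCNM (M ∘ σ) × Star Step M (M ∘ σ) × (∀ {a b} → a ≤ b → key (σ a) ℕ.≤ key (σ b)))
  go M cnm key disj (acc smaller) with any? (λ k → key (suc k) ℕ.<? key (inject₁ k))
  ... | no sorted = (λ i → i) , cnm , ε , adjacent-mono key (λ k → ℕ.≮⇒≥ (λ lt → sorted (k , lt)))
  ... | yes (k , lt) = t ∘ σ , cnm″ , (cnm′ , inj₁ (a , b , ℕ.<⇒≢ a<b ∘ cong toℕ , λ _ _ → refl)) ◅ path , mono
    where
    a b : Fin (suc n)
    a = inject₁ k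
    b = suc k
    t : Fin (suc n) → Fin (suc n)
    t = transpose a b
    adjacent : toℕ b ≡ suc (toℕ a)
    adjacent = cong suc (sym (toℕ-inject₁ k))
    a<b : a < b
    a<b = ℕ.≤-reflexive (sym adjacent)
    cnm′ : IsCNM (M ∘ t)
    cnm′ = isCNM-swap cnm adjacent (disj a b a<b lt)
    -- Exchanging `a` and `b` creates no inversion: the pair itself is now in order, and every other
    -- pair keeps its relative order.
    disj′ : ∀ i j → i < j → key (t j) ℕ.< key (t i) → DisjointRows (M ∘ t) i j
    disj′ i j i<j lt′ = disj (t i) (t j) (transpose-mono-< adjacent i<j ¬ab) lt′
      where
      ¬ab : ¬ (i ≡ a × j ≡ b)
      ¬ab (refl , refl) = ℕ.<-asym lt
        (subst₂ ℕ._<_ (cong key (transpose-right a b)) (cong key (transpose-left a b)) lt′)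
    rec = go (M ∘ t) cnm′ (key ∘ t) disj′ (smaller
      (weight-swap k key (key ∘ t) (cong key (transpose-left a b)) (cong key (transpose-right a b))
        (λ _ i≢a i≢b → cong key (transpose-other i≢a i≢b)) lt))
    σ    = proj₁ rec
    cnm″ = proj₁ (proj₂ rec)
    path = proj₁ (proj₂ (proj₂ rec))
    mono = proj₂ (proj₂ (proj₂ rec))

flip-path : {M M′ : Matrix (suc n)} → Star Step M M′ → Star Step (flip M) (flip M′)
flip-path = gmap flip λ where
  (cnm , inj₁ (a , b , a≢b , e)) → isCNM-flip cnm , inj₂ (a , b , a≢b , flip e)
  (cnm , inj₂ (a , b , a≢b , e)) → isCNM-flip cnm , inj₁ (a , b , a≢b , flip e)

-- Last entries and the key for rows.

module _ (row : Fin n → Bool) where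

  LastEntry : Fin n → Set
  LastEntry j = row j ≡ true × (∀ k → row k ≡ true → k ≤ j)

  EarlierEntry : Fin n → Set
  EarlierEntry j = ∃[ k ] (k < j × row k ≡ true)

  earlierEntry? : Decidable EarlierEntry
  earlierEntry? j = any? (λ k → (k <? j) ×-dec (row k ≟ᵇ true))

  lastEntry : ∃[ j ] row j ≡ true → ∃[ j ] LastEntry j
  lastEntry = greatest (λ j → row j ≟ᵇ true)

  -- Meant for the last entry j of the row.
  rowKey : Fin n → ℕ
  rowKey j with earlierEntry? j
  ... | yes _ = 0
  ... | no _  = suc (toℕ (opposite j))

  rowKey-single : ∀ {j} → ¬ EarlierEntry j → rowKey j ≡ suc (toℕ (opposite j))
  rowKey-single {j} single with earlierEntry? j
  ... | yes e = contradiction e single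
  ... | no _  = refl

  -- The `suc` in the key separates single rows from the others even at the last column, where
  -- `opposite` gives 0.
  rowKey-positive : ∀ {j m} → m ℕ.< rowKey j → ¬ EarlierEntry j
  rowKey-positive {j} lt with earlierEntry? j
  ... | no single = single

-- Disjointness of inverted pairs, and leaves as column ends.

module _ {M : Matrix (suc n)} (cnm : IsCNM M) where

  -- A vertex of row `b` below one of row `a` would, by balance, force a further vertex to the right
  -- of the latter.
  singleRow-disjoint : ∀ {a b j} → LastEntry (M a) j → ¬ EarlierEntry (M a) j → a < b → DisjointRows M a b
  singleRow-disjoint {a} {b} {j} (_ , last) single a<b k v w with to (balanced cnm (a , k) v) (b , a<b , w)
  ... | k′ , k<k′ , v′ = single (k , ℕ.<-≤-trans k<k′ (last k′ v′) , v)

  -- A vertex to the right of the column end would, by balance, force a vertex below it.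
  columnEnd⇒rowEnd : ∀ {c i j} → LastEntry (flip M c) i → LastEntry (M i) j → j ≡ c
  columnEnd⇒rowEnd {c} {i} {j} (v , bottom) (w , last) with <-cmp c j
  ... | tri≈ _ c≡j _ = sym c≡j
  ... | tri> _ _ j<c = contradiction (last c v) (ℕ.<⇒≱ j<c)
  ... | tri< c<j _ _ with from (balanced cnm (i , c) v) (j , c<j , w)
  ...   | i′ , i<i′ , v′ = contradiction (bottom i′ v′) (ℕ.<⇒≱ i<i′)

  -- Suppose row `r` meets both columns. Then both column ends lie strictly below `r`, so they have
  -- a vertex above and none to the left. As they also end their rows, rows `x` and `y` are single,
  -- and the order of their keys gives `b ≤ a`.
  sortedRows⇒disjointColumns :
    (last : Fin (suc n) → Fin (suc n)) → (∀ i → LastEntry (M i) (last i)) →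
    (∀ {i i′} → i ≤ i′ → rowKey (M i) (last i) ℕ.≤ rowKey (M i′) (last i′)) →
    ∀ {a b x y} → LastEntry (flip M a) x → LastEntry (flip M b) y →
    a < b → x < y → DisjointRows (flip M) a b
  sortedRows⇒disjointColumns last isLast sorted {a} {b} {x} {y} endx endy a<b x<y r v w =
    ℕ.<⇒≱ a<b (opposite-cancel-≤ (ℕ.s≤s⁻¹
      (subst₂ ℕ._≤_ (end-key endx r<x v) (end-key endy (ℕ.<-trans r<x x<y) w) (sorted (ℕ.<⇒≤ x<y)))))
    where
    -- The vertex `(r , b)` lies to the right of `(r , a)`, so balance puts a vertex of column `a`
    -- below row `r`.
    r<x : r < x
    r<x with from (balanced cnm (r , a) v) (b , a<b , w)
    ... | r′ , r<r′ , v′ = ℕ.<-≤-trans r<r′ (proj₂ endx r′ v′)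
    end-key : ∀ {c i} → LastEntry (flip M c) i → r < i → Vertex M (r , c) →
              rowKey (M i) (last i) ≡ suc (toℕ (opposite c))
    end-key {c} {i} end r<i u rewrite columnEnd⇒rowEnd end (isLast i) =
      rowKey-single (M i) λ ∃left → noCorner cnm (i , c) (proj₁ end) ((r , r<i , u) , ∃left)

  -- Leaves are exactly the column ends: a vertex below yields a child, and without one balance
  -- excludes a child to the right as well.
  columnEnds⇒upperDiagonal : (∀ j → LastEntry (flip M j) (opposite j)) → UpperDiagonal M
  columnEnds⇒upperDiagonal end i j = mk⇔ leaf⇒ leaf⇐
    where
    leaf⇒ : Leaf M (i , j) → j ≡ opposite i
    leaf⇒ (v , none) with <-cmp i (opposite j)
    ... | tri≈ _ i≡oj _ = trans (sym (opposite-involutive j)) (cong opposite (sym i≡oj))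
    ... | tri> _ _ oj<i = contradiction (proj₂ (end j) i v) (ℕ.<⇒≱ oj<i)
    ... | tri< i<oj _ _ = contradiction (proj₂ (childBelow v (_ , i<oj , proj₁ (end j)))) (none _)
    leaf⇐ : j ≡ opposite i → Leaf M (i , j)
    leaf⇐ refl = v , λ where
        _ (above w _ lt _)  → ∄below (_ , lt , w)
        _ (left w _ _ lt _) → ∄below (from (balanced cnm _ v) (_ , lt , w))
      where
      endᵢ : LastEntry (flip M (opposite i)) i
      endᵢ = subst (LastEntry (flip M (opposite i))) (opposite-involutive i) (end (opposite i))
      v : Vertex M (i , opposite i)
      v = proj₁ endᵢ
      ∄below : ¬ VertexBelow M (i , opposite i)
      ∄below (i′ , i<i′ , w) = ℕ.<⇒≱ i<i′ (proj₂ endᵢ i′ w)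

-- The two successive sorts.

reach-upperDiagonal : (M : Matrix (suc n)) → IsCNM M → ∃[ M′ ] (Star Step M M′ × UpperDiagonal M′)
reach-upperDiagonal {n} M cnm =
  flip (flip M₁ ∘ τ) , path₁ ◅◅ flip-path path₂ ,
  columnEnds⇒upperDiagonal (isCNM-flip cnm₂) λ j →
    subst (LastEntry (M₂ j)) (μ≡opposite j) (isLastμ (τ j))
  where
  last : Fin (suc n) → Fin (suc n)
  last i = proj₁ (lastEntry (M i) (IsCNM.rows cnm i))
  isLast : ∀ i → LastEntry (M i) (last i)
  isLast i = proj₂ (lastEntry (M i) (IsCNM.rows cnm i))
  -- In an inversion the upper row has the larger key, which is therefore positive, so that row is
  -- single.
  sorted₁ = sortRows M cnm (λ i → rowKey (M i) (last i)) λ a b a<b lt →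
    singleRow-disjoint cnm (isLast a) (rowKey-positive (M a) lt) a<b
  σ     = proj₁ sorted₁
  cnm₁  = proj₁ (proj₂ sorted₁)
  path₁ = proj₁ (proj₂ (proj₂ sorted₁))
  mono₁ = proj₂ (proj₂ (proj₂ sorted₁))
  M₁ : Matrix (suc n)
  M₁ = M ∘ σ
  μ : Fin (suc n) → Fin (suc n)
  μ j = proj₁ (lastEntry (flip M₁ j) (IsCNM.columns cnm₁ j))
  isLastμ : ∀ j → LastEntry (flip M₁ j) (μ j)
  isLastμ j = proj₂ (lastEntry (flip M₁ j) (IsCNM.columns cnm₁ j))
  -- Columns are sorted as rows of the transpose; `opposite` turns the ascending sort into one by
  -- descending ends. The data for `M` apply to `M₁` after composing with `σ`, as rows moved whole.
  sorted₂ = sortRows (flip M₁) (isCNM-flip cnm₁) (λ j → toℕ (opposite (μ j))) λ a b a<b lt →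
    sortedRows⇒disjointColumns cnm₁ (last ∘ σ) (isLast ∘ σ) mono₁
      (isLastμ a) (isLastμ b) a<b (opposite-cancel-< lt)
  τ     = proj₁ sorted₂
  cnm₂  = proj₁ (proj₂ sorted₂)
  path₂ = proj₁ (proj₂ (proj₂ sorted₂))
  mono₂ = proj₂ (proj₂ (proj₂ sorted₂))
  M₂ : Matrix (suc n)
  M₂ = flip M₁ ∘ τ
  -- A column end also ends its row, so the column is recovered from the row of its end.
  μ-injective : ∀ {i j} → μ (τ i) ≡ μ (τ j) → i ≡ j
  μ-injective {i} {j} e = trans (sym (rowEnd i)) (trans (cong ℓ e) (rowEnd j))
    where
    ℓ : Fin (suc n) → Fin (suc n)
    ℓ x = proj₁ (lastEntry (flip M₂ x) (IsCNM.columns cnm₂ x))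
    rowEnd : ∀ i → ℓ (μ (τ i)) ≡ i
    rowEnd i = columnEnd⇒rowEnd (isCNM-flip cnm₂) (isLastμ (τ i)) (proj₂ (lastEntry _ (IsCNM.columns cnm₂ _)))
  strict : ∀ {i j} → i < j → opposite (μ (τ i)) < opposite (μ (τ j))
  strict {i} {j} i<j = ≤∧≢⇒< (mono₂ (ℕ.<⇒≤ i<j)) λ e → ℕ.<⇒≢ i<j (cong toℕ (μ-injective
    (trans (sym (opposite-involutive _)) (trans (cong opposite e) (opposite-involutive _)))))
  -- Distinct ends in sorted order form a strictly increasing self-map of the indices, which is the
  -- identity.
  μ≡opposite : ∀ j → μ (τ j) ≡ opposite j
  μ≡opposite j = trans (sym (opposite-involutive _))
    (cong opposite (strictMono⇒id (opposite ∘ μ ∘ τ) strict j))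

-- From paths to indexed sequences.

path⇒sequence : {M M′ : Matrix (suc n)} → IsCNM M → Star Step M M′ →
    ∃[ N ] Σ[ seq ∈ (Fin (suc N) → Matrix (suc n)) ]
    (seq zero ≡ M ×
    (∀ k → IsCNM (seq k)) ×
    (∀ (i : Fin N) → Interchange (seq (inject₁ i)) (seq (suc i))) ×
    seq (fromℕ N) ≡ M′)
path⇒sequence {M = M} cnm ε = 0 , (λ _ → M) , refl , (λ _ → cnm) , (λ ()) , refl
path⇒sequence {M = M} cnm ((cnm′ , step) ◅ path) with path⇒sequence cnm′ path
... | N , seq , refl , cnms , steps , end =
  suc N , (λ { zero → M ; (suc i) → seq i }) , refl ,
  (λ { zero → cnm ; (suc i) → cnms i }) ,
  (λ { zero → step ; (suc i) → steps i }) , end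

theorem4p13 : ∀ (n : ℕ) (M : Matrix (suc n)) → IsCNM M →
    ∃[ N ] Σ[ seq ∈ (Fin (suc N) → Matrix (suc n)) ]
    (seq zero ≡ M ×
    (∀ k → IsCNM (seq k)) ×
    (∀ (i : Fin N) → Interchange (seq (inject₁ i)) (seq (suc i))) ×
    UpperDiagonal (seq (fromℕ N)))
theorem4p13 n M cnm =
  let M′ , path , diagonal = reach-upperDiagonal M cnm
      N , seq , start , cnms , steps , end = path⇒sequence cnm path
  in N , seq , start , cnms , steps , subst UpperDiagonal (sym end) diagonal
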